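{- Let $k \in \omega$ with $k \geq 1$. Then \[ \lim_{n \to \infty}\frac{\left|\{\mathcal{G} \in \mathbb{G}_{k}(n) : (\exists \mathcal{H} \in \mathbb{G}_{k-1}(n))\ \mathcal{G} \cong \mathcal{H}\}\right|}{\left|\mathbb{G}_{k}(n)\right|} = 0. \]
   Context: Notation: $\omega=\{0,1,2,\dots\}$ and $[m]=\{0,1,\dots,m-1\}$; $\mathcal{P}(Z)$ is the power set of $Z$. Graphs are simple undirected graphs. For $k,n\in\omega$, a $k$-rainbow sequence on $[n]$ is a pair $S=(a,e)$ of functions $a:[n]\to[k]$ and $e:[n]\to\mathcal{P}([k])$. The graph associated with $S$ is the graph on vertex set $[n]$ in which, for all $x<y$ in $[n]$, $x$ and $y$ are adjacent if and only if $a(x)\in e(y)$. $\mathbb{G}_k(n)$ denotes the set of all (labelled) graphs on vertex set $[n]$ that are associated with some $k$-rainbow sequence on $[n]$ (the $k$-rainbow threshold graphs on $[n]$). $\cong$ denotes graph isomorphism. -}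

module Defs where

open import Data.Bool.Base using (Bool; true; false)
import Data.Bool.Properties as Bool
open import Data.Fin.Base using (Fin; zero; suc) renaming (_<_ to _<ᶠ_)
import Data.Fin.Properties as Fin
open import Data.Fin.Permutation using (Permutation′; permutation; _⟨$⟩ʳ_; _⟨$⟩ˡ_; inverseˡ; inverseʳ)
open import Data.Fin.Subset using (Subset; _∈_) renaming (⊥ to ∅)
open import Data.Fin.Subset.Properties using (anySubset?; ∉⊥) renaming (_∈?_ to _∈ˢ?_)
open import Data.List.Base using (List; []; _∷_; length; filter; cartesianProductWith)
import Data.List.Membership.Setoid.Properties as Membershipₚ
open import Data.List.Relation.Unary.All as All using (All)
open import Data.List.Relation.Unary.Any as Any using (Any; here; there)
open import Data.List.Relation.Unary.AllPairs using ([]; _∷_)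
open import Data.List.Relation.Unary.Enumerates.Setoid using (IsEnumeration)
open import Data.List.Relation.Unary.Unique.Setoid using (Unique)
import Data.List.Relation.Unary.Unique.Setoid.Properties as Uniqueₚ
open import Data.Nat.Base using (ℕ; zero; suc; pred; _≥_; NonZero)
open import Data.Product.Base using (Σ; ∃; ∃-syntax; _×_; _,_)
open import Data.Rational.Base as ℚ using (ℚ; 0ℚ)
import Data.Vec.Functional as V
open import Function.Base using (_∘_)
open import Function.Bundles using (_⇔_; mk⇔; Equivalence)
open import Level using (0ℓ)
open import Relation.Binary.Bundles using (Setoid)
open import Relation.Binary.Core using (Rel)
open import Relation.Binary.PropositionalEquality as ≡
  using (_≡_; _≗_; refl; sym; trans; cong; subst; _→-setoid_)
open import Relation.Nullary.Decidable using (Dec; map′; _×-dec_; _→-dec_)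
open import Relation.Nullary.Negation using (contradiction)
open import Relation.Unary using (Pred; Decidable)

record Graph (n : ℕ) : Set where
  field
    adj         : Fin n → Fin n → Bool
    symmetric   : ∀ x y → adj x y ≡ adj y x
    irreflexive : ∀ x → adj x x ≡ false

open Graph public

Adjacent : ∀ {n} → Graph n → Fin n → Fin n → Set
Adjacent G x y = adj G x y ≡ true

-- Equality of labelled graphs.  Functions are not extensional here, so
-- this is weaker than _≡_ on the record type, and it is the relation up
-- to which graphs are counted below.
infix 4 _≈_ _≅_

_≈_ : ∀ {n} → Rel (Graph n) 0ℓ
G ≈ H = ∀ x y → adj G x y ≡ adj H x y

graphSetoid : ℕ → Setoid 0ℓ 0ℓ
graphSetoid n = record
  { Carrier       = Graph n
  ; _≈_           = _≈_
  ; isEquivalence = record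
    { refl  = λ _ _ → refl
    ; sym   = λ p x y → sym (p x y)
    ; trans = λ p q x y → trans (p x y) (q x y)
    }
  }

_≅_ : ∀ {n} → Rel (Graph n) 0ℓ
_≅_ {n} G H = Σ (Permutation′ n) λ π →
  ∀ x y → Adjacent G x y ⇔ Adjacent H (π ⟨$⟩ʳ x) (π ⟨$⟩ʳ y)

record RainbowSequence (k n : ℕ) : Set where
  field
    a : Fin n → Fin k
    e : Fin n → Subset k

open RainbowSequence public

-- Only pairs x < y are constrained, as symmetric and irreflexive settle the rest,
-- so S determines G up to _≈_.
AssociatedWith : ∀ {k n} → Graph n → RainbowSequence k n → Set
AssociatedWith G S = ∀ x y → x <ᶠ y → Adjacent G x y ⇔ a S x ∈ e S y

𝔾 : ∀ k n → Pred (Graph n) 0ℓ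
𝔾 k n G = ∃[ S ] AssociatedWith {k} G S

Reducible : ∀ k n → Pred (Graph n) 0ℓ
Reducible k n G = 𝔾 k n G × ∃[ H ] (𝔾 (pred k) n H × G ≅ H)

consRow : ∀ {n} → (Fin n → Bool) → Graph n → Graph (suc n)
consRow r G = record { adj = A ; symmetric = A-sym ; irreflexive = A-irr }
  where
  A : Fin _ → Fin _ → Bool
  A zero    zero    = false
  A zero    (suc y) = r y
  A (suc x) zero    = r x
  A (suc x) (suc y) = adj G x y

  A-sym : ∀ x y → A x y ≡ A y x
  A-sym zero    zero    = refl
  A-sym zero    (suc y) = refl
  A-sym (suc x) zero    = refl
  A-sym (suc x) (suc y) = symmetric G x y

  A-irr : ∀ x → A x x ≡ false
  A-irr zero    = refl
  A-irr (suc x) = irreflexive G x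

rows : ∀ n → List (Fin n → Bool)
rows zero    = (λ ()) ∷ []
rows (suc n) = cartesianProductWith V._∷_ (false ∷ true ∷ []) (rows n)

graphs : ∀ n → List (Graph n)
graphs zero    = record { adj = λ () ; symmetric = λ () ; irreflexive = λ () } ∷ []
graphs (suc n) = cartesianProductWith consRow (rows n) (graphs n)

-- The cardinality of { G | P G }: graphs n lists every graph on [n]
-- exactly once up to _≈_ (graphs-complete, graphs-unique below).
card : ∀ {n} {P : Pred (Graph n) 0ℓ} → Decidable P → ℕ
card {n} P? = length (filter P? (graphs n))

rows-complete : ∀ n → IsEnumeration (Fin n →-setoid Bool) (rows n)
rows-complete zero    r = here (λ ())
rows-complete (suc n) r = Any.map (λ q → trans-∷ q)
  (Membershipₚ.∈-cartesianProductWith⁺ (≡.setoid Bool) (Fin n →-setoid Bool)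
    (Fin (suc n) →-setoid Bool) {f = V._∷_}
    (λ { refl q → λ { zero → refl ; (suc i) → q i } })
    (bool (r zero)) (rows-complete n (r ∘ suc)))
  where
  bool : ∀ b → Any (b ≡_) (false ∷ true ∷ [])
  bool false = here refl
  bool true  = there (here refl)

  trans-∷ : ∀ {s} → (r zero V.∷ (r ∘ suc)) ≗ s → r ≗ s
  trans-∷ q zero    = q zero
  trans-∷ q (suc i) = q (suc i)

rows-unique : ∀ n → Unique (Fin n →-setoid Bool) (rows n)
rows-unique zero    = All.[] ∷ []
rows-unique (suc n) = Uniqueₚ.cartesianProductWith⁺ (≡.setoid Bool)
  (Fin n →-setoid Bool) (Fin (suc n) →-setoid Bool) V._∷_
  (λ q → q zero , q ∘ suc)
  (((λ ()) All.∷ All.[]) ∷ (All.[] ∷ [])) (rows-unique n)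

graphs-complete : ∀ n → IsEnumeration (graphSetoid n) (graphs n)
graphs-complete zero    G = here (λ ())
graphs-complete (suc n) G = Any.map (λ {H} → decompose {H})
  (Membershipₚ.∈-cartesianProductWith⁺ (Fin n →-setoid Bool) (graphSetoid n)
    (graphSetoid (suc n)) {f = consRow}
    (λ {r} {s} {H} {K} → cong-consRow {r} {s} {H} {K})
    (rows-complete n (adj G zero ∘ suc)) (graphs-complete n tail))
  where
  tail : Graph n
  tail = record
    { adj         = λ x y → adj G (suc x) (suc y)
    ; symmetric   = λ x y → symmetric G (suc x) (suc y)
    ; irreflexive = λ x → irreflexive G (suc x)
    }

  cong-consRow : ∀ {r s H K} → r ≗ s → H ≈ K → consRow r H ≈ consRow s K
  cong-consRow p q zero    zero    = refl
  cong-consRow p q zero    (suc y) = p y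
  cong-consRow p q (suc x) zero    = p x
  cong-consRow p q (suc x) (suc y) = q x y

  decompose : ∀ {H} → consRow (adj G zero ∘ suc) tail ≈ H → G ≈ H
  decompose q zero    zero    = trans (irreflexive G zero) (q zero zero)
  decompose q zero    (suc y) = q zero (suc y)
  decompose q (suc x) zero    = trans (symmetric G (suc x) zero) (q (suc x) zero)
  decompose q (suc x) (suc y) = q (suc x) (suc y)

graphs-unique : ∀ n → Unique (graphSetoid n) (graphs n)
graphs-unique zero    = All.[] ∷ []
graphs-unique (suc n) = Uniqueₚ.cartesianProductWith⁺ (Fin n →-setoid Bool)
  (graphSetoid n) (graphSetoid (suc n)) consRow
  (λ q → (λ y → q zero (suc y)) , (λ x y → q (suc x) (suc y)))
  (rows-unique n) (graphs-unique n)

Searchable : Set → Set₁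
Searchable A = ∀ {P : Pred A 0ℓ} → Decidable P → Dec (∃ P)

anyFun? : ∀ {A : Set} → Searchable A → ∀ n {P : Pred (Fin n → A) 0ℓ} →
          (∀ {f g} → f ≗ g → P f → P g) → Decidable P → Dec (∃ P)
anyFun? any zero    resp P? =
  map′ (_ ,_) (λ (f , p) → resp {f} (λ ()) p) (P? (λ ()))
anyFun? any (suc n) {P} resp P? =
  map′ (λ (b , f , p) → (b V.∷ f) , p)
       (λ (f , p) → f zero , f ∘ suc , resp (λ { zero → refl ; (suc i) → refl }) p)
       (any (λ b → anyFun? any n
         (λ q → resp (λ { zero → refl ; (suc i) → q i }))
         (λ f → P? (b V.∷ f))))

_⇔?_ : ∀ {P Q : Set} → Dec P → Dec Q → Dec (P ⇔ Q)
P? ⇔? Q? = map′ (λ (f , g) → mk⇔ f g) (λ e → Equivalence.to e , Equivalence.from e)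
                ((P? →-dec Q?) ×-dec (Q? →-dec P?))

adjacent? : ∀ {n} (G : Graph n) x y → Dec (Adjacent G x y)
adjacent? G x y = adj G x y Bool.≟ true

𝔾? : ∀ k n → Decidable (𝔾 k n)
𝔾? k n G = map′ (λ (a , e , p) → record { a = a ; e = e } , p)
                (λ (S , p) → a S , e S , p)
  (anyFun? Fin.any? n
    (λ q (e , p) → e , λ x y x<y →
      subst (λ c → Adjacent G x y ⇔ c ∈ e y) (q x) (p x y x<y))
    (λ a → anyFun? anySubset? n
      (λ q p x y x<y → subst (λ s → Adjacent G x y ⇔ a x ∈ s) (q y) (p x y x<y))
      (λ e → Fin.all? λ x → Fin.all? λ y →
        (x Fin.<? y) →-dec (adjacent? G x y ⇔? (a x ∈ˢ? e y)))))

𝔾-resp-≈ : ∀ k n {G H} → G ≈ H → 𝔾 k n G → 𝔾 k n H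
𝔾-resp-≈ k n G≈H (S , p) = S , λ x y x<y →
  subst (λ b → (b ≡ true) ⇔ a S x ∈ e S y) (G≈H x y) (p x y x<y)

_≅?_ : ∀ {n} (G H : Graph n) → Dec (G ≅ H)
_≅?_ {n} G H =
  map′ (λ (f , g , fg , gf , p) → permutation f g fg gf , p)
       (λ (π , p) → (π ⟨$⟩ʳ_) , (π ⟨$⟩ˡ_) , (λ _ → inverseʳ π) , (λ _ → inverseˡ π) , p)
  (anyFun? Fin.any? n
    (λ {f} {f′} q (g , fg , gf , p) → g
      , (λ y → trans (sym (q (g y))) (fg y))
      , (λ x → trans (cong g (sym (q x))) (gf x))
      , λ x y → ≡.subst₂ (λ u v → Adjacent G x y ⇔ Adjacent H u v) (q x) (q y) (p x y))
    (λ f → anyFun? Fin.any? n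
      (λ q (fg , gf , p) →
          (λ y → trans (cong f (sym (q y))) (fg y))
        , (λ x → trans (sym (q (f x))) (gf x))
        , p)
      (λ g → Fin.all? (λ y → f (g y) Fin.≟ y)
       ×-dec Fin.all? (λ x → g (f x) Fin.≟ x)
       ×-dec Fin.all? (λ x → Fin.all? λ y →
               adjacent? G x y ⇔? adjacent? H (f x) (f y)))))

≅-respʳ-≈ : ∀ {n} {G H K : Graph n} → H ≈ K → G ≅ H → G ≅ K
≅-respʳ-≈ {G = G} H≈K (π , p) = π , λ x y →
  subst (λ b → Adjacent G x y ⇔ (b ≡ true)) (H≈K _ _) (p x y)

Reducible? : ∀ k n → Decidable (Reducible k n)
Reducible? k n G = 𝔾? k n G ×-dec
  map′ Any.satisfied
       (λ (H , h , G≅H) → Any.map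
         (λ {K} H≈K → 𝔾-resp-≈ (pred k) n {H} {K} H≈K h , ≅-respʳ-≈ {G = G} {H} {K} H≈K G≅H)
         (graphs-complete n H))
       (Any.any? (λ H → 𝔾? (pred k) n H ×-dec (G ≅? H)) (graphs n))

edgeless : ∀ n → Graph n
edgeless n = record
  { adj = λ _ _ → false ; symmetric = λ _ _ → refl ; irreflexive = λ _ → refl }

edgeless∈𝔾 : ∀ k n .{{_ : NonZero k}} → 𝔾 k n (edgeless n)
edgeless∈𝔾 (suc k) n = record { a = λ _ → zero ; e = λ _ → ∅ } , λ x y _ →
  mk⇔ (λ ()) (λ p → contradiction p ∉⊥)

card-𝔾-nonZero : ∀ k n .{{_ : NonZero k}} → NonZero (card (𝔾? k n))
card-𝔾-nonZero k n = nonEmpty {P = edgeless n ≈_}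
    (Membershipₚ.∈-filter⁺ (graphSetoid n) (𝔾? k n)
    (λ {G} {H} → 𝔾-resp-≈ k n {G} {H}) {edgeless n} (graphs-complete n (edgeless n)) (edgeless∈𝔾 k n))
  where
  nonEmpty : ∀ {A : Set} {P : Pred A 0ℓ} {xs} → Any P xs → NonZero (length xs)
  nonEmpty (here _)  = _
  nonEmpty (there _) = _

-- Rational ε suffices: by density this is convergence in ℝ.
_⟶_ : (ℕ → ℚ) → ℚ → Set
f ⟶ L = ∀ (ε : ℚ) → 0ℚ ℚ.< ε → ∃[ N ] (∀ n → n ≥ N → ℚ.∣ f n ℚ.- L ∣ ℚ.< ε)

{-# OPTIONS --safe #-}

-- Read a k-rainbow sequence as a word over an alphabet of size A = k 2ᵏ.  An induced
-- matching with k edges needs k colours in every vertex order: the earlier endpoints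
-- of its edges have pairwise distinct colours.  Hence the words of reducible graphs
-- avoid, as a subsequence, a fixed word of length 2k whose graph is such a matching,
-- and there are only O((A - 1/2)ⁿ) words of this kind.  On the other hand
-- there are at least A ^ (n - 2k) graphs: fixing suitable first k and last k letters,
-- all the letters in between can be read off the graph.

module Submission where

open import Defs
open import Data.Nat.Base using (ℕ; NonZero)
open import Data.Integer.Base using (+_)
open import Data.Rational.Base using (0ℚ; _/_)

open import Data.Bool.Base using (Bool; true; false; not; _∧_; _∨_)
import Data.Bool.Properties as Boolₚ
open import Data.Fin.Base using (Fin; zero; suc; toℕ; _↑ˡ_; _↑ʳ_) renaming (_<_ to _<ᶠ_)
import Data.Fin.Properties as Finₚ
open import Data.Fin.Permutation using (_⟨$⟩ʳ_)
open import Data.Fin.Subset using (Subset; _∈_; ⁅_⁆) renaming (⊥ to ∅)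
open import Data.Fin.Subset.Properties using (x∈⁅x⁆; x∈⁅y⁆⇒x≡y; ∉⊥; ⊆-antisym)
  renaming (_∈?_ to _∈ˢ?_)
import Data.Integer.Base as ℤ
import Data.Integer.Properties as ℤₚ
open import Data.List.Base as List
  using (List; []; _∷_; length; map; filter; allFin; cartesianProduct; cartesianProductWith)
import Data.List.Properties as Listₚ
open import Data.List.Membership.Propositional renaming (_∈_ to _∈ₗ_)
import Data.List.Membership.Propositional.Properties as Memₚ
import Data.List.Membership.Setoid.Properties as SetoidMemₚ
open import Data.List.Relation.Unary.All as All using (All)
import Data.List.Relation.Unary.All.Properties as Allₚ
open import Data.List.Relation.Unary.AllPairs using ([]; _∷_)
open import Data.List.Relation.Unary.Any as Any using (Any; here; there)
import Data.List.Relation.Unary.Any.Properties as Anyₚ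
open import Data.List.Relation.Unary.Unique.Propositional using (Unique)
import Data.List.Relation.Unary.Unique.Propositional.Properties as Uniqueₚ
import Data.List.Relation.Unary.Unique.Setoid as Setoidᵁ
import Data.List.Relation.Unary.Unique.Setoid.Properties as SetoidUniqueₚ
open import Data.Nat.Base using (zero; suc; _+_; _*_; _^_; _≤_; _<_; z<s; s<s; z≤n; s≤s)
import Data.Nat.Base as ℕ
open import Data.Nat.Properties as ℕₚ using (module ≤-Reasoning)
open import Data.Nat.Tactic.RingSolver using (solve-∀)
open import Data.Product.Base using (Σ-syntax; ∃-syntax; _×_; _,_; proj₁; proj₂)
import Data.Product.Properties as Productₚ
open import Data.Rational.Base as ℚ using (ℚ; mkℚ)
import Data.Rational.Properties as ℚₚ
import Data.Rational.Unnormalised.Base as ℚᵘ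
import Data.Rational.Unnormalised.Properties as ℚᵘₚ
open import Data.Sum.Base using (_⊎_; inj₁; inj₂)
open import Data.Vec.Base using (Vec; []; _∷_; _++_; lookup; tabulate)
import Data.Vec.Properties as Vecₚ
open import Function.Base using (_∘_)
open import Function.Bundles using (_⇔_; mk⇔; Equivalence)
open import Level using (0ℓ)
open import Relation.Binary.Bundles using (Setoid)
open import Relation.Binary.Definitions using (DecidableEquality; tri<; tri≈; tri>)
open import Relation.Binary.PropositionalEquality as ≡
  using (_≡_; _≢_; refl; sym; trans; cong; cong₂; subst; subst₂)
open import Relation.Nullary.Decidable using (yes; no; does; ¬?; dec-true; dec-false)
open import Relation.Nullary.Negation using (¬_; contradiction)

private
  variable
    A B C : Set
    k l m n : ℕ

-- Counting with lists

length-cartesianProductWith : ∀ (f : A → B → C) xs ys →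
  length (cartesianProductWith f xs ys) ≡ length xs * length ys
length-cartesianProductWith f []       ys = refl
length-cartesianProductWith f (x ∷ xs) ys = trans (Listₚ.length-++ (map (f x) ys))
  (cong₂ _+_ (Listₚ.length-map (f x) ys) (length-cartesianProductWith f xs ys))

module _ (S : Setoid 0ℓ 0ℓ) where
  open Setoid S using (Carrier) renaming (_≈_ to _∼_; sym to ∼-sym)

  lookup-injective : ∀ {xs} → Setoidᵁ.Unique S xs → ∀ {i j} →
    List.lookup xs i ∼ List.lookup xs j → i ≡ j
  lookup-injective {_ ∷ xs} (x∉ ∷ u) {zero}  {zero}  eq = refl
  lookup-injective {_ ∷ xs} (x∉ ∷ u) {zero}  {suc j} eq =
    contradiction eq (All.lookup x∉ (Memₚ.∈-lookup j))
  lookup-injective {_ ∷ xs} (x∉ ∷ u) {suc i} {zero}  eq =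
    contradiction (∼-sym eq) (All.lookup x∉ (Memₚ.∈-lookup i))
  lookup-injective {_ ∷ xs} (x∉ ∷ u) {suc i} {suc j} eq = cong suc (lookup-injective u eq)

  -- Sending each entry of `xs` to the index of a related entry of `ys` is injective. A relation,
  -- rather than a function, lets the same count compare graphs with words in either direction while
  -- graphs are taken only up to `_≈_`.
  length-≤-by-relation : ∀ {xs} {ys : List B} (R : Carrier → B → Set) →
    (∀ {x x′ y} → R x y → R x′ y → x ∼ x′) →
    Setoidᵁ.Unique S xs → All (λ x → Any (R x) ys) xs → length xs ≤ length ys
  length-≤-by-relation {xs = xs} {ys} R inj u total = Finₚ.injective⇒≤ {f = f} f-injective
    where
    match : ∀ i → Any (R (List.lookup xs i)) ys
    match i = All.lookup total (Memₚ.∈-lookup i)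

    f : Fin (length xs) → Fin (length ys)
    f i = Any.index (match i)

    f-injective : ∀ {i j} → f i ≡ f j → i ≡ j
    f-injective {i} {j} eq = lookup-injective u
      (inj (subst (R _ ∘ List.lookup ys) eq (Anyₚ.lookup-index (match i)))
           (Anyₚ.lookup-index (match j)))

-- Words and subsequences

words : List A → ∀ n → List (Vec A n)
words as zero    = [] ∷ []
words as (suc n) = cartesianProductWith _∷_ as (words as n)

length-words : ∀ (as : List A) n → length (words as n) ≡ length as ^ n
length-words as zero    = refl
length-words as (suc n) = trans (length-cartesianProductWith _∷_ as (words as n))
  (cong (length as *_) (length-words as n))

words-complete : ∀ {as : List A} → (∀ x → x ∈ₗ as) → (w : Vec A n) → w ∈ₗ words as n
words-complete all []      = here refl
words-complete all (x ∷ w) = Memₚ.∈-cartesianProductWith⁺ _∷_ (all x) (words-complete all w)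

words-unique : ∀ {as : List A} → Unique as → ∀ n → Unique (words as n)
words-unique u zero    = All.[] ∷ []
words-unique u (suc n) = Uniqueₚ.cartesianProductWith⁺ _∷_ Vecₚ.∷-injective u (words-unique u n)

Subsequence : Vec A l → Vec A n → Set
Subsequence {l = l} {n = n} p w = Σ[ f ∈ (Fin l → Fin n) ]
  (∀ {i j} → i <ᶠ j → f i <ᶠ f j) × (∀ i → lookup w (f i) ≡ lookup p i)

[]-subsequence : (w : Vec A n) → Subsequence [] w
[]-subsequence w = (λ ()) , (λ {}) , λ ()

∷-subsequence : ∀ x {p : Vec A l} {w : Vec A n} → Subsequence p w → Subsequence (x ∷ p) (x ∷ w)
∷-subsequence {l = l} {n = n} x {p} {w} (f , mono , eq) = g , g-mono , g-eq
  where
  g : Fin (suc l) → Fin (suc n)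
  g zero    = zero
  g (suc i) = suc (f i)

  g-mono : ∀ {i j} → i <ᶠ j → g i <ᶠ g j
  g-mono {zero}  {suc j} _         = z<s
  g-mono {suc i} {suc j} (s<s i<j) = s<s (mono i<j)

  g-eq : ∀ i → lookup (x ∷ w) (g i) ≡ lookup (x ∷ p) i
  g-eq zero    = refl
  g-eq (suc i) = eq i

weaken-subsequence : ∀ x (p : Vec A l) {w : Vec A n} → Subsequence p w → Subsequence p (x ∷ w)
weaken-subsequence x p (f , mono , eq) = suc ∘ f , s<s ∘ mono , eq

module Avoidance (_≟_ : DecidableEquality A) (as : List A) (as-complete : ∀ x → x ∈ₗ as) where

  others : A → List A
  others x = filter (λ y → ¬? (x ≟ y)) as

  -- Words in which the greedy left-to-right search for the pattern fails.
  avoiding : Vec A l → ∀ n → List (Vec A n)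
  avoiding []      n       = []
  avoiding (x ∷ p) zero    = [] ∷ []
  avoiding (x ∷ p) (suc n) =
    map (x ∷_) (avoiding p n) List.++ cartesianProductWith _∷_ (others x) (avoiding (x ∷ p) n)

  subsequence-or-avoiding : ∀ (p : Vec A l) (w : Vec A n) → Subsequence p w ⊎ w ∈ₗ avoiding p n
  subsequence-or-avoiding []      w       = inj₁ ([]-subsequence w)
  subsequence-or-avoiding (x ∷ p) []      = inj₂ (here refl)
  subsequence-or-avoiding (x ∷ p) (y ∷ w) with x ≟ y
  ... | yes refl with subsequence-or-avoiding p w
  ...   | inj₁ s  = inj₁ (∷-subsequence x s)
  ...   | inj₂ w∈ = inj₂ (Memₚ.∈-++⁺ˡ (Memₚ.∈-map⁺ (x ∷_) w∈))
  subsequence-or-avoiding (x ∷ p) (y ∷ w) | no x≢y with subsequence-or-avoiding (x ∷ p) w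
  ...   | inj₁ s  = inj₁ (weaken-subsequence y (x ∷ p) s)
  ...   | inj₂ w∈ = inj₂ (Memₚ.∈-++⁺ʳ (map (x ∷_) (avoiding p _))
    (Memₚ.∈-cartesianProductWith⁺ _∷_
      (Memₚ.∈-filter⁺ (λ y → ¬? (x ≟ y)) (as-complete y) x≢y) w∈))

  length-others : ∀ x → length (others x) < length as
  length-others x = Listₚ.filter-notAll (λ y → ¬? (x ≟ y)) as
    (Any.map (λ x≡y x≢y → x≢y x≡y) (as-complete x))

  -- The count satisfies N(l+1, n+1) ≤ N(l, n) + b N(l+1, n), since at most `b` letters fail to
  -- match. The bound 2^l (b + 1/2)^n solves this recurrence with equality; the factor `2 ^ n`
  -- clears its denominator.
  length-avoiding : ∀ {b} → length as ≡ suc b → (p : Vec A l) → ∀ n →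
    2 ^ n * length (avoiding p n) ≤ 2 ^ l * (1 + 2 * b) ^ n
  length-avoiding eq [] n =
    ℕₚ.≤-trans (ℕₚ.≤-reflexive (ℕₚ.*-zeroʳ (2 ^ n))) z≤n
  length-avoiding {l = suc l} eq (x ∷ p) zero =
    ℕₚ.≤-trans (ℕₚ.m^n>0 2 (suc l)) (ℕₚ.≤-reflexive (sym (ℕₚ.*-identityʳ _)))
  length-avoiding {l = suc l} {b} eq (x ∷ p) (suc n) = begin
    2 * 2 ^ n * length (map (x ∷_) (avoiding p n) List.++ rest)
      ≡⟨ cong (2 * 2 ^ n *_) (trans (Listₚ.length-++ (map (x ∷_) (avoiding p n)))
           (cong₂ _+_ (Listₚ.length-map (x ∷_) (avoiding p n))
             (length-cartesianProductWith _∷_ (others x) (avoiding (x ∷ p) n)))) ⟩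
    2 * 2 ^ n * (u + length (others x) * v)
      ≤⟨ ℕₚ.*-monoʳ-≤ (2 * 2 ^ n) (ℕₚ.+-monoʳ-≤ u (ℕₚ.*-monoˡ-≤ v others≤b)) ⟩
    2 * 2 ^ n * (u + b * v)
      ≡⟨ regroup (2 ^ n) u b v ⟩
    2 * (2 ^ n * u) + 2 * b * (2 ^ n * v)
      ≤⟨ ℕₚ.+-mono-≤ (ℕₚ.*-monoʳ-≤ 2 (length-avoiding eq p n))
           (ℕₚ.*-monoʳ-≤ (2 * b) (length-avoiding eq (x ∷ p) n)) ⟩
    2 * (2 ^ l * c ^ n) + 2 * b * (2 * 2 ^ l * c ^ n)
      ≡⟨ collect (2 ^ l) (c ^ n) b ⟩
    2 * 2 ^ l * (c * c ^ n) ∎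
    where
    open ≤-Reasoning

    c u v : ℕ
    c = 1 + 2 * b
    u = length (avoiding p n)
    v = length (avoiding (x ∷ p) n)

    rest : List (Vec A (suc n))
    rest = cartesianProductWith _∷_ (others x) (avoiding (x ∷ p) n)

    others≤b : length (others x) ≤ b
    others≤b = ℕ.s≤s⁻¹ (subst (length (others x) <_) eq (length-others x))

    regroup : ∀ t u b v → 2 * t * (u + b * v) ≡ 2 * (t * u) + 2 * b * (t * v)
    regroup = solve-∀

    collect : ∀ s t b → 2 * (s * t) + 2 * b * (2 * s * t) ≡ 2 * s * ((1 + 2 * b) * t)
    collect = solve-∀

-- Rainbow sequences as words

Letter : ℕ → Set
Letter k = Fin k × Subset k

_≟ᴸ_ : DecidableEquality (Letter k)
_≟ᴸ_ = Productₚ.≡-dec Finₚ._≟_ (Vecₚ.≡-dec Boolₚ._≟_)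

bits : List Bool
bits = false ∷ true ∷ []

letters : ∀ k → List (Letter k)
letters k = cartesianProduct (allFin k) (words bits k)

letters-complete : (c : Letter k) → c ∈ₗ letters k
letters-complete (i , s) = Memₚ.∈-cartesianProduct⁺ (Memₚ.∈-allFin i)
  (words-complete (λ { false → here refl ; true → there (here refl) }) s)

letters-unique : ∀ k → Unique (letters k)
letters-unique k = Uniqueₚ.cartesianProduct⁺ (Uniqueₚ.allFin⁺ k)
  (words-unique (((λ ()) All.∷ All.[]) ∷ (All.[] ∷ [])) k)

sequence : Vec (Letter k) n → RainbowSequence k n
sequence w = record { a = proj₁ ∘ lookup w ; e = proj₂ ∘ lookup w }

word : RainbowSequence k n → Vec (Letter k) n
word S = tabulate (λ x → a S x , e S x)

associated-word : ∀ (G : Graph n) (S : RainbowSequence k n) →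
  AssociatedWith G S → AssociatedWith G (sequence (word S))
associated-word G S assoc x y x<y =
  subst₂ (λ c d → Adjacent G x y ⇔ proj₁ c ∈ proj₂ d)
    (sym (Vecₚ.lookup∘tabulate _ x)) (sym (Vecₚ.lookup∘tabulate _ y)) (assoc x y x<y)

adjacent⇔∈ : ∀ (G : Graph n) (w : Vec (Letter k) n) → AssociatedWith G (sequence w) →
  ∀ {x y c d} → x <ᶠ y → lookup w x ≡ c → lookup w y ≡ d →
  Adjacent G x y ⇔ proj₁ c ∈ proj₂ d
adjacent⇔∈ G w assoc x<y refl refl = assoc _ _ x<y

adjacent-sym : ∀ (G : Graph n) {x y} → Adjacent G x y → Adjacent G y x
adjacent-sym G {x} {y} = trans (symmetric G y x)

adjacent-irrefl : ∀ (G : Graph n) {x} → ¬ Adjacent G x x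
adjacent-irrefl G {x} p with () ← trans (sym p) (irreflexive G x)

associated-unique : ∀ {G H : Graph n} {S : RainbowSequence k n} →
  AssociatedWith G S → AssociatedWith H S → G ≈ H
associated-unique {G = G} {H} GS HS x y with Finₚ.<-cmp x y
... | tri< x<y _ _ = Boolₚ.⇔→≡ (mk⇔
  (Equivalence.from (HS x y x<y) ∘ Equivalence.to (GS x y x<y))
  (Equivalence.from (GS x y x<y) ∘ Equivalence.to (HS x y x<y)))
... | tri≈ _ refl _ = trans (irreflexive G x) (sym (irreflexive H x))
... | tri> _ _ y<x = trans (symmetric G x y) (trans (Boolₚ.⇔→≡ (mk⇔
  (Equivalence.from (HS y x y<x) ∘ Equivalence.to (GS y x y<x))
  (Equivalence.from (GS y x y<x) ∘ Equivalence.to (HS y x y<x)))) (symmetric H y x))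

-- `edge` is directed from the smaller vertex to the larger, so for `x` and `y` at most one disjunct
-- can hold and the disjunction merely symmetrises it.
graphOf : RainbowSequence k n → Graph n
graphOf {n = n} S = record
  { adj         = λ x y → edge x y ∨ edge y x
  ; symmetric   = λ x y → Boolₚ.∨-comm (edge x y) (edge y x)
  ; irreflexive = λ x → cong₂ _∨_ (loop x) (loop x)
  }
  where
  edge : Fin n → Fin n → Bool
  edge x y = does (x Finₚ.<? y) ∧ does (a S x ∈ˢ? e S y)

  loop : ∀ x → edge x x ≡ false
  loop x = cong (_∧ does (a S x ∈ˢ? e S x)) (dec-false (x Finₚ.<? x) (Finₚ.<-irrefl refl))

graphOf-associated : (S : RainbowSequence k n) → AssociatedWith (graphOf S) S
graphOf-associated S x y x<y
  rewrite dec-true (x Finₚ.<? y) x<y | dec-false (y Finₚ.<? x) (Finₚ.<-asym x<y)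
        | Boolₚ.∨-identityʳ (does (a S x ∈ˢ? e S y))
  with a S x ∈ˢ? e S y
... | yes p = mk⇔ (λ _ → p) (λ _ → refl)
... | no ¬p = mk⇔ (λ ()) (λ p → contradiction p ¬p)

-- Induced matchings

-- Distinctness of the endpoints follows: a vertex shared by edges `i` and `j` is adjacent to the
-- other end of edge `i`, forcing `i ≡ j`, and no vertex is adjacent to itself.
InducedMatching : ∀ m → Graph n → Set
InducedMatching {n} m G = Σ[ p ∈ (Fin m → Bool → Fin n) ]
  (∀ i → Adjacent G (p i false) (p i true)) ×
  (∀ {i j} s t → Adjacent G (p i s) (p j t) → i ≡ j)

-- An induced matching makes no reference to the vertex order, so it survives the relabelling in the
-- definition of `Reducible`.
matching-≅ : ∀ {G H : Graph n} → G ≅ H → InducedMatching m G → InducedMatching m H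
matching-≅ {G = G} {H} (π , iso) (p , edges , induced) =
  (λ i s → π ⟨$⟩ʳ p i s) ,
  (λ i → Equivalence.to (iso _ _) (edges i)) ,
  (λ s t adj → induced s t (Equivalence.from (iso _ _) adj))

module _ {G : Graph n} (S : RainbowSequence k n) (assoc : AssociatedWith G S)
         (M : InducedMatching m G) where

  private
    p = proj₁ M
    edges = proj₁ (proj₂ M)
    induced = proj₂ (proj₂ M)

    -- The Boolean label of an endpoint says nothing about its place in the vertex order, so `s`
    -- records which end comes first.
    orient : ∀ i → Σ[ s ∈ Bool ] p i s <ᶠ p i (not s) × Adjacent G (p i s) (p i (not s))
    orient i with Finₚ.<-cmp (p i false) (p i true)
    ... | tri< lt _ _ = false , lt , edges i
    ... | tri≈ _ eq _ = contradiction
      (subst (Adjacent G (p i false)) (sym eq) (edges i)) (adjacent-irrefl G)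
    ... | tri> _ _ gt = true , gt , adjacent-sym G (edges i)

    first second : Fin m → Fin n
    first  i = p i (proj₁ (orient i))
    second i = p i (not (proj₁ (orient i)))

    first<second : ∀ i → first i <ᶠ second i
    first<second i = proj₁ (proj₂ (orient i))

    -- If second i comes no later than second j, then first i precedes second j, so
    -- equal colours of first i and first j would make first i adjacent to second j.
    same-colour : ∀ i j → toℕ (second i) ≤ toℕ (second j) →
      a S (first i) ≡ a S (first j) → i ≡ j
    same-colour i j le eq = induced _ _
      (Equivalence.from (assoc _ _ (ℕₚ.<-≤-trans (first<second i) le))
        (subst (_∈ e S (second j)) (sym eq)
          (Equivalence.to (assoc _ _ (first<second j)) (proj₂ (proj₂ (orient j))))))

  matching-size : m ≤ k
  matching-size = Finₚ.injective⇒≤ {f = a S ∘ first} λ {i} {j} → injective i j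
    where
    injective : ∀ i j → a S (first i) ≡ a S (first j) → i ≡ j
    -- `same-colour` needs the later endpoints in order; the other case exchanges `i` and `j`.
    injective i j eq with ℕₚ.≤-total (toℕ (second i)) (toℕ (second j))
    ... | inj₁ le = same-colour i j le eq
    ... | inj₂ ge = sym (same-colour j i ge (sym eq))

↑ˡ<↑ʳ : ∀ (i : Fin m) (j : Fin n) → (i ↑ˡ n) <ᶠ (m ↑ʳ j)
↑ˡ<↑ʳ {m} {n} i j rewrite Finₚ.toℕ-↑ˡ i n | Finₚ.toℕ-↑ʳ m j =
  ℕₚ.<-≤-trans (Finₚ.toℕ<n i) (ℕₚ.m≤m+n m (toℕ j))

↑ʳ-mono-< : ∀ m {i j : Fin n} → i <ᶠ j → (m ↑ʳ i) <ᶠ (m ↑ʳ j)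
↑ʳ-mono-< zero    i<j = i<j
↑ʳ-mono-< (suc m) i<j = s<s (↑ʳ-mono-< m i<j)

starts ends : ∀ k → Vec (Letter k) k
starts k = tabulate λ i → i , ∅
ends   k = tabulate λ i → i , ⁅ i ⁆

-- A letter of `starts` is joined to nothing before it; the letter `(i , ⁅ i ⁆)` of `ends` is joined
-- to the earlier vertices of colour `i`, which here means only the start of colour `i`.
matchingWord : ∀ k → Vec (Letter k) (k + k)
matchingWord k = starts k ++ ends k

-- Adjacency of two vertices depends only on their letters and their order, so the chosen positions
-- induce the graph of `matchingWord k`.
subsequence⇒matching : ∀ (G : Graph n) (w : Vec (Letter k) n) →
  AssociatedWith G (sequence w) → Subsequence (matchingWord k) w → InducedMatching k G
subsequence⇒matching {n} {k} G w assoc (f , mono , f-eq) =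
  (λ i s → f (position i s)) , edges , induced
  where
  position : Fin k → Bool → Fin (k + k)
  position i false = i ↑ˡ k
  position i true  = k ↑ʳ i

  neighbours : Fin k → Bool → Subset k
  neighbours i false = ∅
  neighbours i true  = ⁅ i ⁆

  letter : ∀ i s → lookup w (f (position i s)) ≡ (i , neighbours i s)
  letter i false = trans (f-eq _)
    (trans (Vecₚ.lookup-++ˡ (starts k) (ends k) i) (Vecₚ.lookup∘tabulate _ i))
  letter i true  = trans (f-eq _)
    (trans (Vecₚ.lookup-++ʳ (starts k) (ends k) i) (Vecₚ.lookup∘tabulate _ i))

  edges : ∀ i → Adjacent G (f (position i false)) (f (position i true))
  edges i = Equivalence.from
    (adjacent⇔∈ G w assoc (mono (↑ˡ<↑ʳ i i)) (letter i false) (letter i true)) (x∈⁅x⁆ i)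

  -- Both kinds of letter with colour `j` have their set inside `⁅ j ⁆`, so non-adjacency across
  -- pairs needs no case split on the labels.
  ∈neighbours⇒≡ : ∀ {i} j t → i ∈ neighbours j t → i ≡ j
  ∈neighbours⇒≡ j false i∈ = contradiction i∈ ∉⊥
  ∈neighbours⇒≡ j true  i∈ = x∈⁅y⁆⇒x≡y j i∈

  induced< : ∀ {i j} s t → f (position i s) <ᶠ f (position j t) →
    Adjacent G (f (position i s)) (f (position j t)) → i ≡ j
  induced< {i} {j} s t lt adj = ∈neighbours⇒≡ j t
    (Equivalence.to (adjacent⇔∈ G w assoc lt (letter i s) (letter j t)) adj)

  induced : ∀ {i j} s t → Adjacent G (f (position i s)) (f (position j t)) → i ≡ j
  induced {i} {j} s t adj with Finₚ.<-cmp (f (position i s)) (f (position j t))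
  ... | tri< lt _ _ = induced< s t lt adj
  -- Equal positions carry equal letters, and the colour of a letter is its index.
  ... | tri≈ _ eq _ = cong proj₁
    (trans (sym (letter i s)) (trans (cong (lookup w) eq) (letter j t)))
  ... | tri> _ _ gt = sym (induced< t s gt (adjacent-sym G adj))

-- Carried over to `H`, the matching would need `k` colours where only `pred k` are available.
reducible⇒¬matching : ∀ {G : Graph n} .{{_ : NonZero k}} →
  Reducible k n G → ¬ InducedMatching k G
reducible⇒¬matching {k = suc k} {G} (_ , H , (S , assoc) , G≅H) M =
  ℕₚ.1+n≰n (matching-size {G = H} S assoc (matching-≅ {G = G} {H} G≅H M))

-- Bounds on the two cardinalities

module _ (k : ℕ) where
  open Avoidance (_≟ᴸ_ {k}) (letters k) letters-complete

  card-reducible-≤ : ∀ .{{_ : NonZero k}} n →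
    card (Reducible? k n) ≤ length (avoiding (matchingWord k) n)
  card-reducible-≤ n = length-≤-by-relation (graphSetoid n)
    (λ G w → AssociatedWith G (sequence w))
    (λ {G} {H} → associated-unique {G = G} {H})
    (SetoidUniqueₚ.filter⁺ (graphSetoid n) (Reducible? k n) (graphs-unique n))
    (All.map (λ {G} → match G) (Allₚ.all-filter (Reducible? k n) (graphs n)))
    where
    match : ∀ G → Reducible k n G →
      Any (λ w → AssociatedWith G (sequence w)) (avoiding (matchingWord k) n)
    match G red@((S , assoc) , _) with subsequence-or-avoiding (matchingWord k) (word S)
    ... | inj₁ sub = contradiction
      (subsequence⇒matching G (word S) (associated-word G S assoc) sub) (reducible⇒¬matching {G = G} red)
    ... | inj₂ w∈ = Any.map (λ { refl → associated-word G S assoc }) w∈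

padded : Vec (Letter k) m → Vec (Letter k) (k + (m + k))
padded {k} w = starts k ++ (w ++ ends k)

-- The starts show each colour once before the middle, so their edges to a middle vertex spell out
-- its set. Each end tests for a single colour, so the edges from a middle vertex to the ends reveal
-- its colour.
padded-injective : ∀ (G : Graph (k + (m + k))) (w w′ : Vec (Letter k) m) →
  AssociatedWith G (sequence (padded w)) → AssociatedWith G (sequence (padded w′)) → w ≡ w′
padded-injective {k} {m} G w w′ assoc assoc′ =
  trans (sym (Vecₚ.tabulate∘lookup w))
    (trans (Vecₚ.tabulate-cong same) (Vecₚ.tabulate∘lookup w′))
  where
  start end : Fin k → Fin (k + (m + k))
  start i = i ↑ˡ (m + k)
  end   i = k ↑ʳ (m ↑ʳ i)

  middle : Fin m → Fin (k + (m + k))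
  middle x = k ↑ʳ (x ↑ˡ k)

  module Letters (v : Vec (Letter k) m) where
    at-start : ∀ i → lookup (padded v) (start i) ≡ (i , ∅)
    at-start i = trans (Vecₚ.lookup-++ˡ (starts k) (v ++ ends k) i) (Vecₚ.lookup∘tabulate _ i)

    at-middle : ∀ x → lookup (padded v) (middle x) ≡ lookup v x
    at-middle x = trans (Vecₚ.lookup-++ʳ (starts k) (v ++ ends k) (x ↑ˡ k))
      (Vecₚ.lookup-++ˡ v (ends k) x)

    at-end : ∀ i → lookup (padded v) (end i) ≡ (i , ⁅ i ⁆)
    at-end i = trans (Vecₚ.lookup-++ʳ (starts k) (v ++ ends k) (m ↑ʳ i))
      (trans (Vecₚ.lookup-++ʳ v (ends k) i) (Vecₚ.lookup∘tabulate _ i))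

  module Decode (v : Vec (Letter k) m) (assoc : AssociatedWith G (sequence (padded v))) where
    open Letters v

    start-adjacent : ∀ i x → Adjacent G (start i) (middle x) ⇔ i ∈ proj₂ (lookup v x)
    start-adjacent i x = adjacent⇔∈ G (padded v) assoc (↑ˡ<↑ʳ i (x ↑ˡ k)) (at-start i) (at-middle x)

    end-adjacent : ∀ x i → Adjacent G (middle x) (end i) ⇔ proj₁ (lookup v x) ∈ ⁅ i ⁆
    end-adjacent x i =
      adjacent⇔∈ G (padded v) assoc (↑ʳ-mono-< k (↑ˡ<↑ʳ x i)) (at-middle x) (at-end i)

  module D  = Decode w assoc
  module D′ = Decode w′ assoc′

  same : ∀ x → lookup w x ≡ lookup w′ x
  same x = cong₂ _,_
    -- The end vertex used is the one indexed by the colour of `x` in `w`; its edge to `x`, decoded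
    -- through `w′`, gives the same colour.
    (sym (x∈⁅y⁆⇒x≡y _ (Equivalence.to (D′.end-adjacent x _)
      (Equivalence.from (D.end-adjacent x _) (x∈⁅x⁆ _)))))
    (⊆-antisym
      (λ {i} i∈ → Equivalence.to (D′.start-adjacent i x) (Equivalence.from (D.start-adjacent i x) i∈))
      (λ {i} i∈ → Equivalence.to (D.start-adjacent i x) (Equivalence.from (D′.start-adjacent i x) i∈)))

card-𝔾-≥ : ∀ k m → length (letters k) ^ m ≤ card (𝔾? k (k + (m + k)))
card-𝔾-≥ k m = subst (_≤ card (𝔾? k N)) (length-words (letters k) m)
  (length-≤-by-relation (≡.setoid _) R (λ {w} {w′} {G} → padded-injective G w w′)
    (words-unique (letters-unique k) m) (All.universal match _))
  where
  N = k + (m + k)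

  R : Vec (Letter k) m → Graph N → Set
  R w G = AssociatedWith G (sequence (padded w))

  match : ∀ w → Any (R w) (filter (𝔾? k N) (graphs N))
  -- The enumeration contains `graphOf S` only up to `_≈_`, so the association is transported to the
  -- listed `H`.
  match w = Any.map (λ {H} G≈H x y x<y →
      subst (λ b → (b ≡ true) ⇔ _) (G≈H x y) (graphOf-associated S x y x<y))
    (SetoidMemₚ.∈-filter⁺ (graphSetoid N) (𝔾? k N) (λ {G} {H} → 𝔾-resp-≈ k N {G} {H})
      {graphOf S} (graphs-complete N (graphOf S)) (S , graphOf-associated S))
    where
    S = sequence (padded w)

-- Asymptotics

-- For positive `c` this is Bernoulli's inequality 1 + n/c ≤ (1 + 1/c)^n, multiplied by c^(n+1).
bernoulli : ∀ c n → c ^ n * (c + n) ≤ (1 + c) ^ n * c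
bernoulli c zero    = ℕₚ.≤-reflexive (cong (1 *_) (ℕₚ.+-identityʳ c))
bernoulli c (suc n) = begin
  c * c ^ n * (c + suc n)                             ≡⟨ expand c (c ^ n) n ⟩
  c * (c ^ n * (c + n)) + c ^ n * c                   ≤⟨ ℕₚ.+-monoʳ-≤ (c * (c ^ n * (c + n)))
                                                           (ℕₚ.*-monoʳ-≤ (c ^ n) (ℕₚ.m≤m+n c n)) ⟩
  c * (c ^ n * (c + n)) + c ^ n * (c + n)             ≡⟨ ℕₚ.+-comm (c * (c ^ n * (c + n))) _ ⟩
  (1 + c) * (c ^ n * (c + n))                         ≤⟨ ℕₚ.*-monoʳ-≤ (1 + c) (bernoulli c n) ⟩
  (1 + c) * ((1 + c) ^ n * c)                         ≡⟨ sym (ℕₚ.*-assoc (1 + c) ((1 + c) ^ n) c) ⟩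
  (1 + c) * (1 + c) ^ n * c                           ∎
  where
  open ≤-Reasoning

  expand : ∀ c t n → c * t * (c + (1 + n)) ≡ c * (t * (c + n)) + t * c
  expand = solve-∀

^-distribʳ-* : ∀ n x y → (x * y) ^ n ≡ x ^ n * y ^ n
^-distribʳ-* zero    x y = refl
^-distribʳ-* (suc n) x y = trans (cong (x * y *_) (^-distribʳ-* n x y))
  (ℕₚ.[m*n]*[o*p]≡[m*o]*[n*p] x y (x ^ n) (y ^ n))

-- With c = 1 + 2b, so that b + 1 = (1 + c)/2, the hypotheses give u/v ≤ r s (c/(1 + c))^n. By
-- `bernoulli` this is at most r s c/(c + n), which is below 1/q once c + n exceeds q r c s.
exponential-gap : ∀ b r s q {n u v} → q * r * (1 + 2 * b) * s ≤ n →
  2 ^ n * u ≤ r * (1 + 2 * b) ^ n → suc b ^ n ≤ s * v → u * q < v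
exponential-gap b r s q {n} {u} {v} n-large upper lower =
  ℕₚ.*-cancelˡ-< (2 ^ n * (c + n)) (u * q) v (begin-strict
    2 ^ n * (c + n) * (u * q)        ≡⟨ step₁ (2 ^ n) (c + n) u q ⟩
    2 ^ n * u * ((c + n) * q)        ≤⟨ ℕₚ.*-monoˡ-≤ ((c + n) * q) upper ⟩
    r * c ^ n * ((c + n) * q)        ≡⟨ step₂ r (c ^ n) (c + n) q ⟩
    r * q * (c ^ n * (c + n))        ≤⟨ ℕₚ.*-monoʳ-≤ (r * q) (bernoulli c n) ⟩
    r * q * ((1 + c) ^ n * c)        ≡⟨ cong (λ t → r * q * (t ^ n * c)) (double b) ⟩
    r * q * ((2 * suc b) ^ n * c)    ≡⟨ cong (λ t → r * q * (t * c)) (^-distribʳ-* n 2 (suc b)) ⟩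
    r * q * (2 ^ n * suc b ^ n * c)  ≤⟨ ℕₚ.*-monoʳ-≤ (r * q) (ℕₚ.*-monoˡ-≤ c
                                          (ℕₚ.*-monoʳ-≤ (2 ^ n) lower)) ⟩
    r * q * (2 ^ n * (s * v) * c)    ≡⟨ step₃ r q (2 ^ n) s v c ⟩
    -- Strictness comes from `c` being at least 1 and from `v` being positive, which `lower` forces.
    (q * r * c * s) * (2 ^ n * v)    <⟨ ℕₚ.*-monoˡ-< (2 ^ n * v) {{positive}}
                                          (ℕₚ.<-≤-trans (s≤s n-large) (ℕₚ.+-monoˡ-≤ n {1} {c} (s≤s z≤n))) ⟩
    (c + n) * (2 ^ n * v)            ≡⟨ step₄ (c + n) (2 ^ n) v ⟩
    2 ^ n * (c + n) * v              ∎)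
  where
  open ≤-Reasoning

  c = 1 + 2 * b

  v≢0 : NonZero v
  v≢0 = ℕₚ.m*n≢0⇒n≢0 s {{ℕ.>-nonZero (ℕₚ.<-≤-trans (ℕₚ.m^n>0 (suc b) n) lower)}}

  positive : NonZero (2 ^ n * v)
  positive = ℕₚ.m*n≢0 (2 ^ n) v {{ℕₚ.m^n≢0 2 n}} {{v≢0}}

  double : ∀ b → 1 + (1 + 2 * b) ≡ 2 * (1 + b)
  double = solve-∀

  step₁ : ∀ t d u q → t * d * (u * q) ≡ t * u * (d * q)
  step₁ = solve-∀

  step₂ : ∀ r t d q → r * t * (d * q) ≡ r * q * (t * d)
  step₂ = solve-∀

  step₃ : ∀ r q t s v c → r * q * (t * (s * v) * c) ≡ q * r * c * s * (t * v)
  step₃ = solve-∀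

  step₄ : ∀ d t v → d * (t * v) ≡ t * d * v
  step₄ = solve-∀

-- A positive `ε` has numerator at least 1, hence is at least the reciprocal of its denominator; it
-- suffices to beat that reciprocal.
∣/-0∣< : ∀ u v .{{_ : NonZero v}} (ε : ℚ) → 0ℚ ℚ.< ε → u * ℚ.↧ₙ ε < v → ℚ.∣ + u / v ℚ.- 0ℚ ∣ ℚ.< ε
∣/-0∣< u (suc v) (mkℚ (+ zero) _ _) (ℚ.*<* (ℤ.+<+ ())) lt
∣/-0∣< u (suc v) ε@(mkℚ (+ suc p) q _) ε>0 lt =
  subst (ℚ._< ε) (sym abs-eq)
    (ℚₚ.toℚᵘ-cancel-< (ℚᵘₚ.<-respˡ-≃ (ℚᵘₚ.≃-sym (ℚₚ.toℚᵘ-fromℚᵘ (ℚᵘ.mkℚᵘ (+ u) v)))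
      (ℚᵘ.*<* (subst₂ ℤ._<_ (ℤₚ.pos-* u (suc q)) (ℤₚ.pos-* (suc p) (suc v))
        (ℤ.+<+ (ℕₚ.<-≤-trans lt (ℕₚ.m≤m+n (suc v) (p * suc v))))))))
  where
  abs-eq : ℚ.∣ + u / suc v ℚ.- 0ℚ ∣ ≡ + u / suc v
  abs-eq = trans (cong ℚ.∣_∣ (ℚₚ.+-identityʳ (+ u / suc v)))
    (ℚₚ.0≤p⇒∣p∣≡p (ℚₚ.nonNegative⁻¹ (+ u / suc v) {{ℚₚ.normalize-nonNeg u (suc v)}}))

letters-nonEmpty : ∀ k .{{_ : NonZero k}} → ∃[ b ] length (letters k) ≡ suc b
letters-nonEmpty (suc k) with letters (suc k) | letters-complete {suc k} (zero , ∅)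
... | _ ∷ ls | _ = length ls , refl

corollary3p13 : (k : ℕ) .{{_ : NonZero k}} →
    (λ n → _/_ (+ card (Reducible? k n)) (card (𝔾? k n)) {{card-𝔾-nonZero k n}}) ⟶ 0ℚ
-- `threshold` is what `exponential-gap` demands; the extra `k + k` leaves room for the padding.
corollary3p13 k ε ε>0 = threshold + (k + k) , λ n n≥ →
  ∣/-0∣< (card (Reducible? k n)) (card (𝔾? k n)) {{card-𝔾-nonZero k n}} ε ε>0
    (exponential-gap b r s (ℚ.↧ₙ ε) (ℕₚ.m+n≤o⇒m≤o threshold n≥) (upper n)
      (lower n (ℕₚ.m+n≤o⇒n≤o threshold n≥)))
  where
  b = proj₁ (letters-nonEmpty k)
  -- `r` is the factor 2^l of `length-avoiding` for a pattern of length 2k, and `s` counts the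
  -- choices for the 2k letters that the padding fixes.
  r = 2 ^ (k + k)
  s = suc b ^ (k + k)
  threshold = ℚ.↧ₙ ε * r * (1 + 2 * b) * s

  A≡1+b : length (letters k) ≡ suc b
  A≡1+b = proj₂ (letters-nonEmpty k)

  upper : ∀ n → 2 ^ n * card (Reducible? k n) ≤ r * (1 + 2 * b) ^ n
  upper n = ℕₚ.≤-trans (ℕₚ.*-monoʳ-≤ (2 ^ n) (card-reducible-≤ k n))
    (Avoidance.length-avoiding _≟ᴸ_ (letters k) letters-complete A≡1+b (matchingWord k) n)

  lower : ∀ n → k + k ≤ n → suc b ^ n ≤ s * card (𝔾? k n)
  lower n 2k≤n with ℕₚ.m≤n⇒∃[o]m+o≡n 2k≤n
  ... | m , eq = subst (λ n → suc b ^ n ≤ s * card (𝔾? k n)) (trans (reorder k m) eq) (begin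
    suc b ^ (k + (m + k))              ≡⟨ cong (suc b ^_) (reorder k m) ⟩
    suc b ^ (k + k + m)                ≡⟨ ℕₚ.^-distribˡ-+-* (suc b) (k + k) m ⟩
    s * suc b ^ m                      ≡⟨ cong (λ t → s * t ^ m) (sym A≡1+b) ⟩
    s * length (letters k) ^ m         ≤⟨ ℕₚ.*-monoʳ-≤ s (card-𝔾-≥ k m) ⟩
    s * card (𝔾? k (k + (m + k)))      ∎)
    where
    open ≤-Reasoning

    reorder : ∀ k m → k + (m + k) ≡ k + k + m
    reorder = solve-∀
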